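{- Let $\mathcal{M}_1,\mathcal{M}_2$ be locally finite structures in languages $\mathcal{L}_1,\mathcal{L}_2$, respectively, with the same domain $M$. Assume that for all (same-length, finite) tuples $\bar a,\bar b$ from $M$, $\mathrm{qftp}_{\mathcal{M}_1}(\bar a)=\mathrm{qftp}_{\mathcal{M}_1}(\bar b)$ if, and only if, $\mathrm{qftp}_{\mathcal{M}_2}(\bar a)=\mathrm{qftp}_{\mathcal{M}_2}(\bar b)$. Then $\mathcal{M}_1$ has the embedding Ramsey property if, and only if, $\mathcal{M}_2$ has the embedding Ramsey property.
   Context: A structure is locally finite if every finite subset generates a finite substructure. $\mathrm{qftp}$ denotes complete quantifier-free type over $\emptyset$. $\mathrm{Age}(\mathcal{M})$ is the class of (isomorphism types of) finitely generated substructures of $\mathcal{M}$. For structures $A,C$, $\binom{C}{A}$ is the set of embeddings $A\to C$. For $A\subseteq B$, write $C\to(B)^A_2$ if for every $\chi:\binom{C}{A}\to\{0,1\}$ there is an embedding $e:B\to C$ such that $\chi$ is constant on $\{e\circ f:f\in\binom{B}{A}\}$. A structure $\mathcal{M}$ has the embedding Ramsey property if for all $A\subseteq B$ in $\mathrm{Age}(\mathcal{M})$ there is $C\in\mathrm{Age}(\mathcal{M})$ with $C\to(B)^A_2$. -}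

module Defs where

open import Data.Fin.Base using (Fin)
open import Data.Nat.Base using (ℕ)
open import Data.Product.Base using (Σ-syntax; ∃; ∃-syntax; _×_; _,_; proj₁; proj₂)
open import Data.Sum.Base using (_⊎_)
open import Data.Vec.Functional using (Vector; map)
open import Data.Vec.Functional.Relation.Binary.Pointwise using (Pointwise)
open import Function.Base using (_∘_)
open import Function.Bundles using (Func; Surjection; _⇔_; mk⇔; Equivalence)
open import Function.Definitions using (Congruent; Injective; Surjective)
open import Level using (Level; suc)
open import Relation.Binary.Bundles using (Setoid)
open import Relation.Binary.Definitions using (_Respects_)
import Relation.Binary.Construct.On as On
import Relation.Binary.PropositionalEquality.Properties as ≡
open import Relation.Binary.PropositionalEquality.Core using (_≡_)
open import Relation.Nullary.Negation.Core using (¬_)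
open import Relation.Unary using (Pred; _∈_)

-- Constants are the function symbols of arity 0.
record Language (ℓ : Level) : Set (suc ℓ) where
  field
    FunSym : ℕ → Set ℓ
    RelSym : ℕ → Set ℓ

-- The domain is a setoid because a substructure is a subset given by a
-- predicate, whose elements must be compared without their membership proofs.
-- Domains may be empty.
record Structure {ℓ : Level} (L : Language ℓ) (D : Setoid ℓ ℓ) : Set (suc ℓ) where
  open Language L
  open Setoid D using (Carrier; _≈_)
  field
    fun      : ∀ {k} → FunSym k → Vector Carrier k → Carrier
    rel      : ∀ {k} → RelSym k → Pred (Vector Carrier k) ℓ
    fun-cong : ∀ {k} (f : FunSym k) → Congruent (Pointwise _≈_) _≈_ (fun f)
    rel-resp : ∀ {k} (R : RelSym k) → rel R Respects Pointwise _≈_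

module _ {ℓ : Level} (L : Language ℓ) where
  open Language L

  data Term (n : ℕ) : Set ℓ where
    var : Fin n → Term n
    app : ∀ {k} → FunSym k → Vector (Term n) k → Term n

  data QFFormula (n : ℕ) : Set ℓ where
    _≈ᶠ_    : Term n → Term n → QFFormula n
    relᶠ    : ∀ {k} → RelSym k → Vector (Term n) k → QFFormula n
    ¬ᶠ_     : QFFormula n → QFFormula n
    _∧ᶠ_    : QFFormula n → QFFormula n → QFFormula n
    _∨ᶠ_    : QFFormula n → QFFormula n → QFFormula n

module _ {ℓ : Level} {L : Language ℓ} {D : Setoid ℓ ℓ} (M : Structure L D) where
  open Language L
  open Setoid D using (Carrier; _≈_)
  open Structure M

  eval : ∀ {n} → Vector Carrier n → Term L n → Carrier
  eval a (var i)    = a i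
  eval a (app f ts) = fun f (λ i → eval a (ts i))

  Satisfies : ∀ {n} → Vector Carrier n → QFFormula L n → Set ℓ
  Satisfies a (s ≈ᶠ t)    = eval a s ≈ eval a t
  Satisfies a (relᶠ R ts) = rel R (λ i → eval a (ts i))
  Satisfies a (¬ᶠ φ)      = ¬ Satisfies a φ
  Satisfies a (φ ∧ᶠ ψ)    = Satisfies a φ × Satisfies a ψ
  Satisfies a (φ ∨ᶠ ψ)    = Satisfies a φ ⊎ Satisfies a ψ

  qftp : ∀ {n} → Vector Carrier n → Pred (QFFormula L n) ℓ
  qftp = Satisfies

  record Substructure : Set (suc ℓ) where
    field
      member : Pred Carrier ℓ
      resp   : member Respects _≈_
      closed : ∀ {k} (f : FunSym k) (xs : Vector Carrier k) →
               (∀ i → xs i ∈ member) → fun f xs ∈ member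

  -- The least subset that contains the tuple and is closed under the function
  -- symbols (and under the equality of the domain).
  data Generated {n} (a : Vector Carrier n) : Pred Carrier ℓ where
    generator : ∀ i → Generated a (a i)
    apply     : ∀ {k} (f : FunSym k) (xs : Vector Carrier k) →
                (∀ i → Generated a (xs i)) → Generated a (fun f xs)
    respects  : ∀ {x y} → x ≈ y → Generated a x → Generated a y

  ⟨_⟩ : ∀ {n} → Vector Carrier n → Substructure
  ⟨ a ⟩ = record { member = Generated a ; resp = respects ; closed = apply }

  FinitelyGenerated : Set ℓ
  FinitelyGenerated = ∃[ n ] Σ[ a ∈ Vector Carrier n ] (∀ x → x ∈ Generated a)

  domain : Substructure → Setoid ℓ ℓ
  domain N = On.setoid {B = ∃ (Substructure.member N)} D proj₁

  induced : (N : Substructure) → Structure L (domain N)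
  induced N = record
    { fun      = λ f xs → fun f (proj₁ ∘ xs) , closed f (proj₁ ∘ xs) (proj₂ ∘ xs)
    ; rel      = λ R xs → rel R (proj₁ ∘ xs)
    ; fun-cong = λ f xs≈ys → fun-cong f xs≈ys
    ; rel-resp = λ R xs≈ys → rel-resp R xs≈ys
    }
    where open Substructure N

-- Listability by some Fin n; classically this is the same as being in bijection
-- with some Fin n, and constructively it does not demand decidable equality.
Finite : {ℓ : Level} → Setoid ℓ ℓ → Set ℓ
Finite S = ∃[ n ] Surjection (≡.setoid (Fin n)) S

-- Finite subsets are given by finite tuples listing their elements.
LocallyFinite : {ℓ : Level} {L : Language ℓ} {D : Setoid ℓ ℓ} → Structure L D → Set ℓ
LocallyFinite {D = D} M =
  ∀ n (a : Vector (Setoid.Carrier D) n) → Finite (domain M (⟨_⟩ M a))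

module _ {ℓ : Level} {L : Language ℓ} where
  open Language L

  record Embedding {D E : Setoid ℓ ℓ} (A : Structure L D) (B : Structure L E) : Set ℓ where
    private
      module D = Setoid D
      module E = Setoid E
      module A = Structure A
      module B = Structure B
    field
      to        : D.Carrier → E.Carrier
      cong      : Congruent D._≈_ E._≈_ to
      injective : Injective D._≈_ E._≈_ to
      fun-homo  : ∀ {k} (f : FunSym k) (xs : Vector D.Carrier k) →
                  to (A.fun f xs) E.≈ B.fun f (map to xs)
      rel-iff   : ∀ {k} (R : RelSym k) (xs : Vector D.Carrier k) →
                  A.rel R xs ⇔ B.rel R (map to xs)

  open Embedding using (to)

  _∘ᵉ_ : {D E F : Setoid ℓ ℓ} {A : Structure L D} {B : Structure L E} {C : Structure L F} →
         Embedding B C → Embedding A B → Embedding A C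
  _∘ᵉ_ {F = F} {C = C} g f = record
    { to        = to g ∘ to f
    ; cong      = λ x≈y → g.cong (f.cong x≈y)
    ; injective = λ eq → f.injective (g.injective eq)
    ; fun-homo  = λ h xs → Setoid.trans F (g.cong (f.fun-homo h xs)) (g.fun-homo h (map (to f) xs))
    ; rel-iff   = λ R xs →
        let p = f.rel-iff R xs
            q = g.rel-iff R (map (to f) xs)
        in mk⇔ (Equivalence.to q ∘ Equivalence.to p) (Equivalence.from p ∘ Equivalence.from q)
    }
    where
      module f = Embedding f
      module g = Embedding g

  -- The set of embeddings A → C. Embeddings are equal when they are equal as
  -- functions, so a colouring below cannot depend on the proof components.
  embeddings : {D F : Setoid ℓ ℓ} → Structure L F → Structure L D → Setoid ℓ ℓ
  embeddings {D} {F} C A = record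
    { Carrier       = Embedding A C
    ; _≈_           = λ f g → ∀ x → to f x ≈ to g x
    ; isEquivalence = record
      { refl  = λ x → refl
      ; sym   = λ p x → sym (p x)
      ; trans = λ p q x → trans (p x) (q x)
      }
    }
    where open Setoid F using (_≈_; refl; sym; trans)

  Colouring : {D F : Setoid ℓ ℓ} → Structure L F → Structure L D → Set ℓ
  Colouring C A = Func (embeddings C A) (≡.setoid (Fin 2))

  -- C → (B)^A_2
  _⟶[_]^_ : {D E F : Setoid ℓ ℓ} → Structure L F → Structure L E → Structure L D → Set ℓ
  C ⟶[ B ]^ A =
    (χ : Colouring C A) →
    Σ[ e ∈ Embedding B C ]
      (∀ (f g : Embedding A B) → Func.to χ (e ∘ᵉ f) ≡ Func.to χ (e ∘ᵉ g))

  _≅_ : {D E : Setoid ℓ ℓ} → Structure L D → Structure L E → Set ℓ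
  _≅_ {D} {E} A B =
    Σ[ f ∈ Embedding A B ] Surjective (Setoid._≈_ D) (Setoid._≈_ E) (to f)

  -- The age as an isomorphism-closed class of structures.
  InAge : {D E : Setoid ℓ ℓ} → Structure L D → Structure L E → Set (suc ℓ)
  InAge M A = Σ[ N ∈ Substructure M ] FinitelyGenerated (induced M N) × A ≅ induced M N

  EmbeddingRamsey : {D : Setoid ℓ ℓ} → Structure L D → Set (suc ℓ)
  EmbeddingRamsey M =
    ∀ {E : Setoid ℓ ℓ} (B : Structure L E) (A : Substructure B) →
    InAge M (induced B A) → InAge M B →
    Σ[ F ∈ Setoid ℓ ℓ ] Σ[ C ∈ Structure L F ]
      InAge M C × (C ⟶[ B ]^ induced B A)

{-# OPTIONS --safe #-}

-- For locally finite M the embedding Ramsey property is equivalent to a partition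
-- property of finite tuples of M that mentions only the relation "same
-- quantifier-free type". A member of the age is finite, so it is listed by a tuple
-- of M; an embedding is determined by the image of such a tuple, and any tuple of
-- the same quantifier-free type occurs as an image.
module Submission where

open import Defs
open import Level using (Level; _⊔_)
open import Relation.Binary.Bundles using (Setoid)
open import Relation.Unary using (_≐_; _∈_)
open import Data.Vec.Functional using (Vector)
open import Function.Bundles using (_⇔_)

open import Data.Fin.Base using (Fin)
open import Data.Nat.Base using (ℕ)
open import Data.Product.Base using (∃; Σ-syntax; ∃-syntax; _×_; _,_; proj₁; proj₂)
open import Data.Product.Function.NonDependent.Propositional using (_×-⇔_)
open import Data.Sum.Function.Propositional using (_⊎-⇔_)
open import Data.Vec.Functional.Relation.Binary.Pointwise using (Pointwise)
open import Function.Base using (_∘_; id)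
open import Function.Bundles using (Equivalence; Func; Surjection; mk⇔)
open import Function.Construct.Symmetry using (⇔-sym)
open import Function.Related.TypeIsomorphisms using (¬-cong-⇔)
open import Relation.Binary.PropositionalEquality.Core as ≡ using (_≡_)
import Relation.Binary.PropositionalEquality.Properties as ≡
open import Relation.Unary.Properties using (≐-sym; ≐-trans)

open Embedding using (to)

-- Finite setoids and their listings.

module _ {ℓ : Level} (S : Setoid ℓ ℓ) where
  open Setoid S

  listing⇒Finite : ∀ {n} (v : Vector Carrier n) → (∀ x → ∃[ i ] v i ≈ x) → Finite S
  listing⇒Finite {n} v index = n , record
    { to         = v
    ; cong       = λ { ≡.refl → refl }
    ; surjective = λ x → let i , vi≈x = index x in i , λ { ≡.refl → vi≈x }
    }

  -- `index` is a chosen section of `elem` and need not respect the equality of `S`: equal elements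
  -- may receive different positions.
  module Listing (finite : Finite S) where
    size : ℕ
    size = proj₁ finite

    open Surjection (proj₂ finite) public
      using () renaming (to to elem; to⁻ to index; to∘to⁻ to elem∘index)

-- Generated substructures, embeddings and quantifier-free types.

module _ {ℓ : Level} {L : Language ℓ} {D : Setoid ℓ ℓ} (X : Structure L D) where
  open Setoid D
  open Structure X

  inclusion : (N : Substructure X) → Embedding (induced X N) X
  inclusion N = record
    { to        = proj₁
    ; cong      = id
    ; injective = id
    ; fun-homo  = λ f xs → refl
    ; rel-iff   = λ R xs → mk⇔ id id
    }

  -- A derivation of membership is a term once its `respects` steps are erased. The term depends on
  -- the derivation, so equal elements can get different terms.
  term : ∀ {n} {a : Vector Carrier n} {x} → x ∈ Generated X a → Term L n
  term (generator i)    = var i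
  term (apply f xs gs)  = app f (λ i → term (gs i))
  term (respects x≈y g) = term g

  eval-term : ∀ {n} {a : Vector Carrier n} {x} (g : x ∈ Generated X a) →
              eval X a (term g) ≈ x
  eval-term (generator i)    = refl
  eval-term (apply f xs gs)  = fun-cong f (λ i → eval-term (gs i))
  eval-term (respects x≈y g) = trans (eval-term g) x≈y

module _ {ℓ : Level} {L : Language ℓ} {D E : Setoid ℓ ℓ}
         {X : Structure L D} {Y : Structure L E} (h : Embedding X Y) where
  private
    module D = Setoid D
    module E = Setoid E
    module X = Structure X
    module Y = Structure Y
    module h = Embedding h

  Generated-image : ∀ {n} {a : Vector D.Carrier n} {x} →
                    x ∈ Generated X a → h.to x ∈ Generated Y (h.to ∘ a)
  Generated-image (generator i)    = generator i
  Generated-image (apply f xs gs)  = respects (E.sym (h.fun-homo f xs))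
                                       (apply f _ (λ i → Generated-image (gs i)))
  Generated-image (respects x≈y g) = respects (h.cong x≈y) (Generated-image g)

  -- Induction on the derivation, replaying each function symbol in `X`. It serves both for
  -- surjectivity onto a generated substructure and for pulling generation back along an embedding.
  Generated-preimage : ∀ {n} {a : Vector D.Carrier n} {b : Vector E.Carrier n} →
                       Pointwise E._≈_ (h.to ∘ a) b → ∀ {y} → y ∈ Generated Y b →
                       ∃[ x ] x ∈ Generated X a × h.to x E.≈ y
  Generated-preimage {a = a} ha≈b (generator i) = a i , generator i , ha≈b i
  Generated-preimage ha≈b (apply f ys gs) =
    X.fun f xs , apply f xs (λ i → proj₁ (proj₂ (pre i))) ,
    E.trans (h.fun-homo f xs) (Y.fun-cong f (λ i → proj₂ (proj₂ (pre i))))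
    where
    pre = λ i → Generated-preimage ha≈b (gs i)
    xs  = λ i → proj₁ (pre i)
  Generated-preimage ha≈b (respects y≈z g) =
    let x , gx , hx≈y = Generated-preimage ha≈b g in x , gx , E.trans hx≈y y≈z

  module _ {n} {a : Vector D.Carrier n} {b : Vector E.Carrier n}
           (ha≈b : Pointwise E._≈_ (h.to ∘ a) b) where

    eval-embedding : (t : Term L n) → h.to (eval X a t) E.≈ eval Y b t
    eval-embedding (var i)    = ha≈b i
    eval-embedding (app f ts) =
      E.trans (h.fun-homo f _) (Y.fun-cong f (λ i → eval-embedding (ts i)))

    -- Both directions go through the induction together because negation swaps them. Equations are
    -- reflected by injectivity.
    Satisfies-embedding : (φ : QFFormula L n) → Satisfies X a φ ⇔ Satisfies Y b φ
    Satisfies-embedding (s ≈ᶠ t) = mk⇔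
      (λ p → E.trans (E.sym (eval-embedding s)) (E.trans (h.cong p) (eval-embedding t)))
      (λ q → h.injective (E.trans (eval-embedding s) (E.trans q (E.sym (eval-embedding t)))))
    Satisfies-embedding (relᶠ R ts) = mk⇔
      (λ p → Y.rel-resp R (λ i → eval-embedding (ts i)) (Equivalence.to (h.rel-iff R _) p))
      (λ q → Equivalence.from (h.rel-iff R _)
               (Y.rel-resp R (λ i → E.sym (eval-embedding (ts i))) q))
    Satisfies-embedding (¬ᶠ φ)   = ¬-cong-⇔ (Satisfies-embedding φ)
    Satisfies-embedding (φ ∧ᶠ ψ) = Satisfies-embedding φ ×-⇔ Satisfies-embedding ψ
    Satisfies-embedding (φ ∨ᶠ ψ) = Satisfies-embedding φ ⊎-⇔ Satisfies-embedding ψ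

    qftp-embedding : qftp X a ≐ qftp Y b
    qftp-embedding = (λ {φ} → Equivalence.to (Satisfies-embedding φ))
                   , (λ {φ} → Equivalence.from (Satisfies-embedding φ))

module _ {ℓ : Level} {L : Language ℓ} {D E : Setoid ℓ ℓ}
         (X : Structure L D) (Y : Structure L E) where
  private
    module D = Setoid D
    module E = Setoid E
    module X = Structure X
    module Y = Structure Y

  abstract
    -- A converse to `qftp-embedding`: each element of `X` is the value of a term at `a`, and is
    -- sent to the value of that term at `b`. Well-definedness and every clause of being an
    -- embedding are instances of atomic formulas, which the equality of types transfers.
    extend : ∀ {n} {a : Vector D.Carrier n} {b : Vector E.Carrier n} →
             (∀ x → x ∈ Generated X a) → qftp X a ≐ qftp Y b →
             Σ[ h ∈ Embedding X Y ] Pointwise E._≈_ (to h ∘ a) b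
    extend {n} {a} {b} gen (X⊆Y , Y⊆X) = record
      { to        = λ x → eval Y b (t x)
      ; cong      = λ {x} {y} x≈y → X⊆Y {t x ≈ᶠ t y}
                      (D.trans (t-eval x) (D.trans x≈y (D.sym (t-eval y))))
      ; injective = λ {x} {y} eq →
                      D.trans (D.sym (t-eval x)) (D.trans (Y⊆X {t x ≈ᶠ t y} eq) (t-eval y))
      ; fun-homo  = λ f xs → X⊆Y {t (X.fun f xs) ≈ᶠ app f (t ∘ xs)}
                      (D.trans (t-eval _) (D.sym (X.fun-cong f (λ i → t-eval (xs i)))))
      ; rel-iff   = λ R xs → mk⇔
                      (λ p → X⊆Y {relᶠ R (t ∘ xs)}
                               (X.rel-resp R (λ i → D.sym (t-eval (xs i))) p))
                      (λ q → X.rel-resp R (λ i → t-eval (xs i)) (Y⊆X {relᶠ R (t ∘ xs)} q))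
      } , λ i → X⊆Y {t (a i) ≈ᶠ var i} (t-eval (a i))
      where
      t : D.Carrier → Term L n
      t x = term X (gen x)

      t-eval : ∀ x → eval X a (t x) D.≈ x
      t-eval x = eval-term X (gen x)

module _ {ℓ : Level} {L : Language ℓ} {D : Setoid ℓ ℓ} (X : Structure L D) where
  open Setoid D

  generators : ∀ {n} (a : Vector Carrier n) → Vector (∃ (Generated X a)) n
  generators a i = a i , generator i

  -- A derivation carried out in `X` has to be repeated inside the substructure; taking a preimage
  -- along the inclusion does this.
  generators-generate : ∀ {n} (a : Vector Carrier n) x →
                        x ∈ Generated (induced X (⟨_⟩ X a)) (generators a)
  generators-generate a (_ , g) =
    let _ , gx , x≈ = Generated-preimage (inclusion X (⟨_⟩ X a)) (λ i → refl) g
    in respects x≈ gx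

-- Members of the age.

module _ {ℓ : Level} {L : Language ℓ} {D E : Setoid ℓ ℓ}
         (M : Structure L D) (X : Structure L E) where
  private
    module D = Setoid D
    module E = Setoid E

  InAge⇒embedding : InAge M X → Embedding X M
  InAge⇒embedding (N , _ , f , _) = inclusion M N ∘ᵉ f

  -- Preimages of the generators under the isomorphism generate: every `x` has the same image as
  -- some generated element, and injectivity identifies the two.
  InAge⇒FinitelyGenerated : InAge M X → FinitelyGenerated X
  InAge⇒FinitelyGenerated (N , (n , a , gen) , f , surj) =
    n , (λ i → proj₁ (surj (a i))) , λ x →
    let _ , gx , fx≈ = Generated-preimage f (λ i → proj₂ (surj (a i)) E.refl) (gen (to f x))
    in respects (Embedding.injective f fx≈) gx

  abstract
    -- The isomorphic copy is the substructure generated by the images of the generators of `X`;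
    -- `Generated-preimage` shows that it contains nothing outside the image.
    embedding⇒InAge : Embedding X M → FinitelyGenerated X → InAge M X
    embedding⇒InAge h (n , a , gen) =
      ⟨_⟩ M b , (n , generators M b , generators-generate M b) ,
      record
        { to        = λ x → h.to x , Generated-image h (gen x)
        ; cong      = h.cong
        ; injective = h.injective
        ; fun-homo  = h.fun-homo
        ; rel-iff   = h.rel-iff
        } ,
      λ (_ , g) → let x , _ , hx≈y = Generated-preimage h (λ i → D.refl) g
                  in x , λ z≈x → D.trans (h.cong z≈x) hx≈y
      where
      module h = Embedding h
      b : Vector D.Carrier n
      b = h.to ∘ a

  abstract
    -- Local finiteness lists the substructure of `M` generated by the images of the generators.
    -- This listing pulls back along `h`, and injectivity shows that the preimages exhaust `X`.
    InAge⇒Finite : LocallyFinite M → InAge M X → Finite E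
    InAge⇒Finite locFin age =
      listing⇒Finite E (λ i → proj₁ (pre i)) λ x →
      let y = h.to x , Generated-image h (gen x)
      in index y , h.injective (D.trans (proj₂ (proj₂ (pre (index y)))) (elem∘index y))
      where
      h : Embedding X M
      h = InAge⇒embedding age
      module h = Embedding h

      fg : FinitelyGenerated X
      fg = InAge⇒FinitelyGenerated age

      a : Vector E.Carrier (proj₁ fg)
      a = proj₁ (proj₂ fg)

      gen : ∀ x → x ∈ Generated X a
      gen = proj₂ (proj₂ fg)

      open Listing (domain M (⟨_⟩ M (h.to ∘ a))) (locFin _ (h.to ∘ a))

      pre : ∀ i → ∃[ x ] x ∈ Generated X a × h.to x D.≈ proj₁ (elem i)
      pre i = Generated-preimage h (λ _ → D.refl) (proj₂ (elem i))

-- The partition property of tuples.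

module _ {ℓ : Level} (D : Setoid ℓ ℓ) where
  open Setoid D

  TupleRelation : ∀ r → Set (ℓ ⊔ Level.suc r)
  TupleRelation r = ∀ {n} → Vector Carrier n → Vector Carrier n → Set r

  -- Copies are equal when they are equal as tuples: the listing c may repeat elements.
  Copies : ∀ {r} → TupleRelation r → ∀ {k m} → Vector Carrier k → Vector Carrier m →
           Setoid r ℓ
  Copies _~_ {k} {m} a c = record
    { Carrier       = Σ[ ρ ∈ (Fin k → Fin m) ] (c ∘ ρ) ~ a
    ; _≈_           = λ (ρ , _) (ρ′ , _) → Pointwise _≈_ (c ∘ ρ) (c ∘ ρ′)
    ; isEquivalence = record
      { refl  = λ i → refl
      ; sym   = λ p i → sym (p i)
      ; trans = λ p q i → trans (p i) (q i)
      }
    }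

  -- Here `b ∘ σ` stands for `A` inside `B`, `c` for `C`, and `τ` for the embedding of `B` into `C`.
  -- The copies are tested on `c ∘ τ ∘ ρ` rather than on `b ∘ ρ`, since an arbitrary relation need
  -- not pass to reindexed tuples.
  TupleRamsey : ∀ {r} → TupleRelation r → Set (ℓ ⊔ r)
  TupleRamsey _~_ =
    ∀ {k n} (b : Vector Carrier n) (σ : Fin k → Fin n) →
    ∃[ m ] Σ[ c ∈ Vector Carrier m ]
      ((χ : Func (Copies _~_ (b ∘ σ) c) (≡.setoid (Fin 2))) →
       Σ[ τ ∈ (Fin n → Fin m) ] (c ∘ τ) ~ b ×
         (∀ ρ ρ′ (p : (c ∘ τ ∘ ρ) ~ (b ∘ σ)) (p′ : (c ∘ τ ∘ ρ′) ~ (b ∘ σ)) →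
          Func.to χ (τ ∘ ρ , p) ≡ Func.to χ (τ ∘ ρ′ , p′)))

  TupleRamsey-resp : ∀ {r s} {_~_ : TupleRelation r} {_∼_ : TupleRelation s} →
                     (∀ n (a b : Vector Carrier n) → (a ~ b) ⇔ (a ∼ b)) →
                     TupleRamsey _~_ → TupleRamsey _∼_
  TupleRamsey-resp iff ramsey b σ =
    let m , c , arrow = ramsey b σ in m , c , λ χ →
    let τ , p , mono = arrow (record
          { to   = λ (ρ , q) → Func.to χ (ρ , Equivalence.to (iff _ _ _) q)
          ; cong = λ eq → Func.cong χ eq })
    in τ , Equivalence.to (iff _ _ _) p , λ ρ ρ′ q q′ →
       -- The round trip through `iff` may change the proof component of a copy, but equality of
       -- copies ignores it, so the colour is unchanged.
       ≡.trans (Func.cong χ (λ i → refl))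
         (≡.trans (mono ρ ρ′ (Equivalence.from (iff _ _ _) q) (Equivalence.from (iff _ _ _) q′))
           (Func.cong χ (λ i → refl)))

-- Equivalence of the two Ramsey properties for a locally finite structure.

module _ {ℓ : Level} {L : Language ℓ} {D : Setoid ℓ ℓ} (M : Structure L D)
         (locFin : LocallyFinite M) where
  open Setoid D

  SameQFType : TupleRelation D ℓ
  SameQFType a b = qftp M a ≐ qftp M b

  -- The tuple `c` lists the image of `C` in `M`, which is possible by local finiteness. A colouring
  -- of the copies inside `c` then induces a colouring of the embeddings of `A` into `C`.
  EmbeddingRamsey⇒TupleRamsey : EmbeddingRamsey M → TupleRamsey D SameQFType
  EmbeddingRamsey⇒TupleRamsey ramsey {k} {n} b σ = size , c , arrow
    where
    B = induced M (⟨_⟩ M b)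
    b̂ = generators M b
    A′ = ⟨_⟩ B (b̂ ∘ σ)
    A = induced B A′
    â = generators B (b̂ ∘ σ)

    B⊆M : Embedding B M
    B⊆M = inclusion M (⟨_⟩ M b)

    A⊆B : Embedding A B
    A⊆B = inclusion B A′

    gen-B = generators-generate M b
    gen-A = generators-generate B (b̂ ∘ σ)

    R = ramsey B A′
          (embedding⇒InAge M A (B⊆M ∘ᵉ A⊆B) (k , â , gen-A))
          (embedding⇒InAge M B B⊆M (n , b̂ , gen-B))
    F = proj₁ R
    C = proj₁ (proj₂ R)
    C∈Age = proj₁ (proj₂ (proj₂ R))
    C⟶B = proj₂ (proj₂ (proj₂ R))

    open Listing F (InAge⇒Finite M C locFin C∈Age)

    j : Embedding C M
    j = InAge⇒embedding M C C∈Age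
    module j = Embedding j

    c : Vector Carrier size
    c = j.to ∘ elem

    c∘index : ∀ x → j.to x ≈ c (index x)
    c∘index x = sym (j.cong (elem∘index x))

    A-qftp : qftp A â ≐ qftp M (b ∘ σ)
    A-qftp = qftp-embedding (B⊆M ∘ᵉ A⊆B) (λ i → refl)

    arrow : (χ : Func (Copies D SameQFType (b ∘ σ) c) (≡.setoid (Fin 2))) →
            Σ[ τ ∈ (Fin n → Fin size) ] SameQFType (c ∘ τ) b ×
              (∀ ρ ρ′ p p′ → Func.to χ (τ ∘ ρ , p) ≡ Func.to χ (τ ∘ ρ′ , p′))
    arrow χ = pull (C⟶B χ′)
      where
      copy : Embedding A C → Setoid.Carrier (Copies D SameQFType (b ∘ σ) c)
      copy f = (λ i → index (to f (â i))) ,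
               ≐-trans (≐-sym (qftp-embedding (j ∘ᵉ f) (λ i → c∘index _))) A-qftp

      χ′ : Colouring C A
      χ′ = record
        { to   = Func.to χ ∘ copy
        -- Equal embeddings may yield different positions, but the entries of `c` there agree, and
        -- only those entries are compared.
        ; cong = λ f≈g → Func.cong χ (λ i →
            trans (sym (c∘index _)) (trans (j.cong (f≈g (â i))) (c∘index _)))
        }

      module _ (e : Embedding B C) where
        τ : Fin n → Fin size
        τ i = index (to e (b̂ i))

        τ-copy : SameQFType (c ∘ τ) b
        τ-copy = ≐-trans (≐-sym (qftp-embedding (j ∘ᵉ e) (λ i → c∘index _)))
                         (qftp-embedding B⊆M (λ i → refl))

        module _ (ρ : Fin k → Fin n) (p : SameQFType (c ∘ τ ∘ ρ) (b ∘ σ)) where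
          -- Pulled back along `j ∘ᵉ e`, the hypothesis `p` says that `b̂ ∘ ρ` has in `B` the type
          -- that `â` has in `A`, so `ρ` comes from an embedding of `A` into `B`.
          lift : Σ[ f ∈ Embedding A B ] (∀ i → proj₁ (to f (â i)) ≈ b (ρ i))
          lift = extend A B gen-A
            (≐-trans A-qftp
              (≐-trans (≐-sym p)
                (≐-sym (qftp-embedding (j ∘ᵉ e) {a = b̂ ∘ ρ} (λ i → c∘index _)))))

          χ-lift : Func.to χ (τ ∘ ρ , p) ≡ Func.to χ (copy (e ∘ᵉ proj₁ lift))
          -- Up to equality, both copies consist of the images of `b̂ ∘ ρ` under `j ∘ᵉ e`.
          χ-lift = Func.cong χ λ i →
            trans (sym (c∘index _))
              (trans (sym (Embedding.cong (j ∘ᵉ e) (proj₂ lift i))) (c∘index _))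

      pull : Σ[ e ∈ Embedding B C ] (∀ f g → Func.to χ′ (e ∘ᵉ f) ≡ Func.to χ′ (e ∘ᵉ g)) →
             Σ[ τ ∈ (Fin n → Fin size) ] SameQFType (c ∘ τ) b ×
               (∀ ρ ρ′ p p′ → Func.to χ (τ ∘ ρ , p) ≡ Func.to χ (τ ∘ ρ′ , p′))
      pull (e , mono) = τ e , τ-copy e , λ ρ ρ′ p p′ →
        ≡.trans (χ-lift e ρ p)
          (≡.trans (mono (proj₁ (lift e ρ p)) (proj₁ (lift e ρ′ p′)))
            (≡.sym (χ-lift e ρ′ p′)))

  -- `A` and `B` are listed by all their elements, not just by generators. Every element of `A`, and
  -- every image of it under an embedding into `B`, is then an entry of the listing of `B`, so these
  -- embeddings become index maps.
  TupleRamsey⇒EmbeddingRamsey : TupleRamsey D SameQFType → EmbeddingRamsey M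
  TupleRamsey⇒EmbeddingRamsey ramsey {E} B A′ A∈Age B∈Age =
    _ , C , embedding⇒InAge M C C⊆M (m , generators M c , generators-generate M c) , arrow
    where
    A = induced B A′
    module E = Setoid E
    module LA = Listing (domain B A′) (InAge⇒Finite M A locFin A∈Age)
    module LB = Listing E (InAge⇒Finite M B locFin B∈Age)

    A⊆B : Embedding A B
    A⊆B = inclusion B A′

    j : Embedding B M
    j = InAge⇒embedding M B B∈Age
    module j = Embedding j

    b : Vector Carrier LB.size
    b = j.to ∘ LB.elem

    σ : Fin LA.size → Fin LB.size
    σ i = LB.index (proj₁ (LA.elem i))

    R = ramsey b σ
    m = proj₁ R
    c = proj₁ (proj₂ R)

    C = induced M (⟨_⟩ M c)
    ĉ = generators M c

    C⊆M : Embedding C M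
    C⊆M = inclusion M (⟨_⟩ M c)

    A-qftp : qftp A LA.elem ≐ qftp M (b ∘ σ)
    A-qftp = qftp-embedding (j ∘ᵉ A⊆B) (λ i → sym (j.cong (LB.elem∘index _)))

    B-qftp : qftp B LB.elem ≐ qftp M b
    B-qftp = qftp-embedding j (λ i → refl)

    C-qftp : ∀ {k} (ρ : Fin k → Fin m) → qftp C (ĉ ∘ ρ) ≐ qftp M (c ∘ ρ)
    C-qftp ρ = qftp-embedding C⊆M (λ i → refl)

    gen-A : ∀ x → x ∈ Generated A LA.elem
    gen-A x = respects (LA.elem∘index x) (generator _)

    gen-B : ∀ x → x ∈ Generated B LB.elem
    gen-B x = respects (LB.elem∘index x) (generator _)

    arrow : C ⟶[ B ]^ A
    arrow χ = e , mono
      where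
      lift : ((ρ , _) : Setoid.Carrier (Copies D SameQFType (b ∘ σ) c)) →
             Σ[ f ∈ Embedding A C ] (∀ i → proj₁ (to f (LA.elem i)) ≈ c (ρ i))
      lift (ρ , p) = extend A C gen-A (≐-trans A-qftp (≐-sym (≐-trans (C-qftp ρ) p)))

      -- Makes the colour of a copy depend on its entries alone, and later identifies `e ∘ᵉ f` with
      -- the embedding chosen by `lift`.
      determined : (f g : Embedding A C) →
                   (∀ i → proj₁ (to f (LA.elem i)) ≈ proj₁ (to g (LA.elem i))) →
                   ∀ x → proj₁ (to f x) ≈ proj₁ (to g x)
      determined f g eq x =
        trans (sym (Embedding.cong f (LA.elem∘index x)))
          (trans (eq (LA.index x)) (Embedding.cong g (LA.elem∘index x)))

      χ′ : Func (Copies D SameQFType (b ∘ σ) c) (≡.setoid (Fin 2))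
      χ′ = record
        { to   = λ q → Func.to χ (proj₁ (lift q))
        ; cong = λ {q} {q′} eq → Func.cong χ
            (determined (proj₁ (lift q)) (proj₁ (lift q′)) λ i →
              trans (proj₂ (lift q) i) (trans (eq i) (sym (proj₂ (lift q′) i))))
        }

      τ = proj₁ (proj₂ (proj₂ R) χ′)
      p = proj₁ (proj₂ (proj₂ (proj₂ R) χ′))

      e-extends : Σ[ e ∈ Embedding B C ] (∀ i → proj₁ (to e (LB.elem i)) ≈ c (τ i))
      e-extends = extend B C gen-B (≐-trans B-qftp (≐-sym (≐-trans (C-qftp τ) p)))
      e = proj₁ e-extends

      module _ (f : Embedding A B) where
        ρ : Fin LA.size → Fin LB.size
        -- A position for the image exists because `LB.elem` reaches all of `B`; `τ` then carries it
        -- to a position in `c`.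
        ρ i = LB.index (to f (LA.elem i))

        e∘f : ∀ i → proj₁ (to e (to f (LA.elem i))) ≈ c (τ (ρ i))
        e∘f i = trans (sym (Embedding.cong e (LB.elem∘index _))) (proj₂ e-extends (ρ i))

        ρ-copy : SameQFType (c ∘ τ ∘ ρ) (b ∘ σ)
        ρ-copy = ≐-trans (≐-sym (qftp-embedding (C⊆M ∘ᵉ (e ∘ᵉ f)) e∘f)) A-qftp

        χ-e∘f : Func.to χ (e ∘ᵉ f) ≡ Func.to χ′ (τ ∘ ρ , ρ-copy)
        χ-e∘f = Func.cong χ
          (determined (e ∘ᵉ f) (proj₁ (lift (τ ∘ ρ , ρ-copy))) λ i →
            trans (e∘f i) (sym (proj₂ (lift (τ ∘ ρ , ρ-copy)) i)))

      mono : (f g : Embedding A B) → Func.to χ (e ∘ᵉ f) ≡ Func.to χ (e ∘ᵉ g)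
      mono f g =
        ≡.trans (χ-e∘f f)
          (≡.trans (proj₂ (proj₂ (proj₂ (proj₂ R) χ′)) (ρ f) (ρ g) (ρ-copy f) (ρ-copy g))
            (≡.sym (χ-e∘f g)))

-- The tuple property sees a structure only through `SameQFType`, which `iff` matches across the two
-- languages. Local finiteness of `M₁` lists the Ramsey witness; that of `M₂` lists the two
-- structures to be arrowed.
EmbeddingRamsey-transfer :
  ∀ {ℓ : Level} {L₁ L₂ : Language ℓ} {D : Setoid ℓ ℓ}
  (M₁ : Structure L₁ D) (M₂ : Structure L₂ D) →
  LocallyFinite M₁ → LocallyFinite M₂ →
  (∀ n (a b : Vector (Setoid.Carrier D) n) →
    (qftp M₁ a ≐ qftp M₁ b) ⇔ (qftp M₂ a ≐ qftp M₂ b)) →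
  EmbeddingRamsey M₁ → EmbeddingRamsey M₂
EmbeddingRamsey-transfer {D = D} M₁ M₂ lf₁ lf₂ iff =
  TupleRamsey⇒EmbeddingRamsey M₂ lf₂ ∘
  TupleRamsey-resp D iff ∘
  EmbeddingRamsey⇒TupleRamsey M₁ lf₁

lemma6p2 : ∀ {ℓ : Level} {L₁ L₂ : Language ℓ} {M : Setoid ℓ ℓ}
    (M₁ : Structure L₁ M) (M₂ : Structure L₂ M) →
    LocallyFinite M₁ → LocallyFinite M₂ →
    (∀ n (a b : Vector (Setoid.Carrier M) n) →
    (qftp M₁ a ≐ qftp M₁ b) ⇔ (qftp M₂ a ≐ qftp M₂ b)) →
    EmbeddingRamsey M₁ ⇔ EmbeddingRamsey M₂
lemma6p2 M₁ M₂ lf₁ lf₂ iff = mk⇔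
  (EmbeddingRamsey-transfer M₁ M₂ lf₁ lf₂ iff)
  (EmbeddingRamsey-transfer M₂ M₁ lf₂ lf₁ (λ n a b → ⇔-sym (iff n a b)))
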